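{- Two-path-free happy compressed temporal graphs have $O(n\log n)$ edges; that is, there is a constant $C>0$ such that every two-path-free happy compressed temporal graph $\mathcal{G}=(V,E,\lambda)$ with $n=|V|\ge 2$ vertices satisfies $|E|\le C\, n\log n$.
   Context: A happy temporal graph is a triple $\mathcal{G}=(V,E,\lambda)$ where $(V,E)$ is a finite simple undirected graph (the footprint) and $\lambda:E\to\{1,2,3,\dots\}$ assigns a single time label to each edge, such that two distinct edges sharing an endpoint have different labels. It is compressed if for every edge $e$ with $\lambda(e)>1$ there is an edge $e'$ adjacent to $e$ with $\lambda(e')=\lambda(e)-1$. A temporal walk is a walk in the footprint along which edge labels are strictly increasing (so no edge is repeated). $\mathcal{G}$ is two-path-free if for all distinct $u,v\in V$ there is at most one temporal walk from $u$ to $v$. -}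

module Defs where

open import Data.Fin.Base using (Fin; _<_)
open import Data.Fin.Properties using (_<?_)
open import Data.List.Base using (List; []; _∷_; length; filter; cartesianProduct; allFin)
open import Data.List.Relation.Unary.Linked using (Linked)
open import Data.Nat.Base as ℕ using (ℕ; suc)
open import Data.Product.Base using (_×_; _,_; Σ-syntax; ∃-syntax)
open import Data.Sum.Base using (_⊎_)
open import Level using (0ℓ)
open import Relation.Binary.Construct.Closure.ReflexiveTransitive using (Star; ε; _◅_)
open import Relation.Binary.Core using (Rel)
open import Relation.Binary.Definitions using (Decidable; Symmetric; Irreflexive; Irrelevant)
open import Relation.Binary.PropositionalEquality.Core using (_≡_; _≢_)
open import Relation.Nullary.Decidable using (_×-dec_)

-- An undirected edge {u , v} appears as both u ~ v and v ~ u.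
-- Irrelevance of _~_ says that there are no parallel edges, so that two
-- inhabitants of Star _~_ are equal exactly when they visit the same vertices
-- in the same order.
record SimpleGraph (n : ℕ) : Set₁ where
  infix 4 _~_ _~?_
  field
    _~_          : Rel (Fin n) 0ℓ
    _~?_         : Decidable _~_
    ~-sym        : Symmetric _~_
    ~-irrefl     : Irreflexive _≡_ _~_
    ~-irrelevant : Irrelevant _~_

  Walk : Rel (Fin n) 0ℓ
  Walk = Star _~_

  -- Each undirected edge is listed once, smaller endpoint first.
  edges : List (Fin n × Fin n)
  edges = filter (λ (u , v) → (u <? v) ×-dec (u ~? v))
                 (cartesianProduct (allFin n) (allFin n))

  ∣E∣ : ℕ
  ∣E∣ = length edges

record HappyTemporalGraph (n : ℕ) : Set₁ where
  field
    footprint : SimpleGraph n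

  open SimpleGraph footprint public

  field
    label     : ∀ {u v} → u ~ v → ℕ
    label-sym : ∀ {u v} (e : u ~ v) → label (~-sym e) ≡ label e
    label-pos : ∀ {u v} (e : u ~ v) → 1 ℕ.≤ label e
    -- By symmetry any two edges sharing an endpoint can be oriented to start
    -- there; they are then distinct iff their other endpoints differ.
    proper    : ∀ {u v w} (e : u ~ v) (f : u ~ w) → v ≢ w → label e ≢ label f

  -- The edge f at u or at v is automatically different from e, since its
  -- label is.
  Compressed : Set
  Compressed = ∀ {u v} (e : u ~ v) → 1 ℕ.< label e →
    ∃[ w ] ((Σ[ f ∈ u ~ w ] label f ≡ label e ℕ.∸ 1)
          ⊎ (Σ[ f ∈ v ~ w ] label f ≡ label e ℕ.∸ 1))

  labels : ∀ {u v} → Walk u v → List ℕ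
  labels ε       = []
  labels (e ◅ p) = label e ∷ labels p

  IsTemporal : ∀ {u v} → Walk u v → Set
  IsTemporal p = Linked ℕ._<_ (labels p)

  TwoPathFree : Set
  TwoPathFree = ∀ {u v} → u ≢ v → (p q : Walk u v) →
    IsTemporal p → IsTemporal q → p ≡ q

{-# OPTIONS --safe #-}
-- Let S k v be the set of vertices with a temporal walk to v using labels ≤ k only.
-- If an edge v ~ w has label k + 1, then S k v and S k w are disjoint, as a common
-- element would have two temporal walks to v or to w; hence
-- ∣S (k + 1) v∣ = ∣S k v∣ + ∣S k w∣.
-- Charge each edge to its endpoint with the smaller set just before the edge appears.
-- Every charge to v at least doubles ∣S k v∣, which starts at 1 and never exceeds n,
-- so each vertex is charged at most log₂ n times.
module Submission where

open import Data.Nat.Base using (ℕ; zero; suc; pred; z≤n; s≤s; z<s; _+_; _*_; _^_; _≤_; _<_; _⊔_)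
open import Data.Nat.Logarithm using (⌊log₂_⌋; ⌊log₂⌋-mono-≤; ⌊log₂[2^n]⌋≡n)
open import Data.Nat.Properties
open import Data.Product.Base using (_×_; _,_; proj₁; proj₂; ∃-syntax; Σ-syntax)
open import Data.Fin.Base as Fin using (Fin)
open import Data.Fin.Properties as Fin using (any?; injective⇒≤)
open import Data.List.Base using (List; []; _∷_; [_]; _++_; length; filter; map; lookup; allFin; cartesianProduct)
open import Data.List.Membership.Propositional using (_∈_)
open import Data.List.Membership.Propositional.Properties using (∈-allFin; ∈-lookup)
open import Data.List.Properties using (length-++; length-map; length-tabulate)
open import Data.List.Relation.Binary.Disjoint.Propositional using (Disjoint)
open import Data.List.Relation.Unary.All as All using (All; []; _∷_)
open import Data.List.Relation.Unary.All.Properties as All using (all-filter)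
open import Data.List.Relation.Unary.AllPairs using ([]; _∷_)
open import Data.List.Relation.Unary.Any using (here; there)
open import Data.List.Relation.Unary.Linked using (Linked; []; [-]; _∷_)
open import Data.List.Relation.Unary.Unique.Propositional using (Unique)
open import Data.List.Relation.Unary.Unique.Propositional.Properties as Unique
open import Data.Empty using (⊥)
open import Function.Base using (_∘_; id)
open import Level using (Level)
open import Relation.Binary.Construct.Closure.ReflexiveTransitive using (ε; _◅_; _◅◅_)
open import Relation.Binary.PropositionalEquality using (_≡_; _≢_; refl; sym; trans; cong; subst)
open import Relation.Nullary using (¬_; yes; no; contradiction)
open import Relation.Nullary.Decidable using (¬?)
open import Relation.Unary using (Pred; Decidable)
open import Defs

-- Counting in lists without repetitions.

private variable
  a b p : Level
  A : Set a
  B : Set b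

length-filter-¬ : {P : Pred A p} (P? : Decidable P) (xs : List A) →
  length xs ≡ length (filter P? xs) + length (filter (¬? ∘ P?) xs)
length-filter-¬ P? [] = refl
length-filter-¬ P? (x ∷ xs) with P? x
... | yes _ = cong suc (length-filter-¬ P? xs)
... | no  _ = trans (cong suc (length-filter-¬ P? xs)) (sym (+-suc _ _))

-- Injectivity is asked only on `P`, because the maps used later are injective only on restricted
-- pairs: those with the smaller vertex first, or those with a fixed first component.
map-unique : {P : Pred A p} (f : A → B) →
  (∀ {x y} → P x → P y → f x ≡ f y → x ≡ y) →
  ∀ {xs} → All P xs → Unique xs → Unique (map f xs)
map-unique f inj [] [] = []
map-unique f inj (px ∷ pxs) (x∉ ∷ u) =
  All.map⁺ (All.map (λ (py , x≢y) eq → x≢y (inj px py eq)) (All.zip (pxs , x∉)))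
  ∷ map-unique f inj pxs u

lookup-injective : ∀ {xs : List A} → Unique xs →
  ∀ {i j} → lookup xs i ≡ lookup xs j → i ≡ j
lookup-injective (x∉ ∷ u) {Fin.zero}  {Fin.zero}  eq = refl
lookup-injective (x∉ ∷ u) {Fin.zero}  {Fin.suc j} eq = contradiction eq (All.lookup x∉ (∈-lookup j))
lookup-injective (x∉ ∷ u) {Fin.suc i} {Fin.zero}  eq = contradiction (sym eq) (All.lookup x∉ (∈-lookup i))
lookup-injective (x∉ ∷ u) {Fin.suc i} {Fin.suc j} eq = cong Fin.suc (lookup-injective u eq)

unique-length : ∀ {n} {xs : List (Fin n)} → Unique xs → length xs ≤ n
unique-length u = injective⇒≤ (lookup-injective u)

-- Induction on the list of values, removing the fibre over the head. `P` is carried along because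
-- the bound on a fibre may depend on it, as it does for charged pairs.
length≤fibres : ∀ {n m} {P : Pred A p} (f : A → Fin n) →
  (∀ i {xs} → Unique xs → All P xs → All (λ x → f x ≡ i) xs → length xs ≤ m) →
  ∀ is {xs} → Unique xs → All P xs → All (λ x → f x ∈ is) xs → length xs ≤ length is * m
length≤fibres f fibre [] u [] [] = z≤n
length≤fibres f fibre [] u (_ ∷ _) (() ∷ _)
length≤fibres {m = m} f fibre (i ∷ is) {xs} u pxs f∈ = begin
  length xs                                              ≡⟨ length-filter-¬ f≟i xs ⟩
  length (filter f≟i xs) + length (filter (¬? ∘ f≟i) xs)
    ≤⟨ +-mono-≤
         (fibre i (Unique.filter⁺ f≟i u) (All.filter⁺ f≟i pxs) (all-filter f≟i xs))
         (length≤fibres f fibre is (Unique.filter⁺ (¬? ∘ f≟i) u) (All.filter⁺ (¬? ∘ f≟i) pxs)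
           (All.map drop-head (All.zip (all-filter (¬? ∘ f≟i) xs , All.filter⁺ (¬? ∘ f≟i) f∈)))) ⟩
  m + length is * m                                      ∎
  where
  open ≤-Reasoning
  f≟i = λ x → f x Fin.≟ i
  drop-head : ∀ {x} → ¬ f x ≡ i × f x ∈ i ∷ is → f x ∈ is
  drop-head (f≢i , here f≡i) = contradiction f≡i f≢i
  drop-head (f≢i , there f∈) = f∈

-- Supplies a time by which all edges charged to a vertex have appeared, where the induction on time
-- can start.
bounded : (f : A → ℕ) (xs : List A) → ∃[ k ] All (λ x → f x ≤ k) xs
bounded f [] = 0 , []
bounded f (x ∷ xs) with bounded f xs
... | k , fxs≤k = f x ⊔ k , m≤m⊔n (f x) k ∷ All.map (λ fy≤k → ≤-trans fy≤k (m≤n⊔m (f x) k)) fxs≤k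

2^m≤n⇒m≤⌊log₂n⌋ : ∀ m {n} → 2 ^ m ≤ n → m ≤ ⌊log₂ n ⌋
2^m≤n⇒m≤⌊log₂n⌋ m 2^m≤n = subst (_≤ _) (⌊log₂[2^n]⌋≡n m) (⌊log₂⌋-mono-≤ 2^m≤n)

-- Labels as a total function on ordered pairs of vertices.

module _ {n} (G : HappyTemporalGraph n) (tpf : HappyTemporalGraph.TwoPathFree G) where
  open HappyTemporalGraph G

  -- 0 stands for a missing edge.
  lab : Fin n → Fin n → ℕ
  lab v w with v ~? w
  ... | yes e = label e
  ... | no  _ = 0

  lab-label : ∀ {v w} (e : v ~ w) → lab v w ≡ label e
  lab-label {v} {w} e with v ~? w
  ... | yes f = cong label (~-irrelevant f e)
  ... | no ¬e = contradiction e ¬e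

  lab-edge : ∀ {v w} → 0 < lab v w → v ~ w
  lab-edge {v} {w} 0<l with v ~? w
  ... | yes e = e
  lab-edge () | no _

  lab-sym : ∀ {v w} → 0 < lab v w → lab v w ≡ lab w v
  lab-sym 0<l = let e = lab-edge 0<l in
    trans (lab-label e) (trans (sym (label-sym e)) (sym (lab-label (~-sym e))))

  suc-edge : ∀ {k v w} → lab v w ≡ suc k → Σ[ e ∈ v ~ w ] label e ≡ suc k
  suc-edge eq = let e = lab-edge (subst (0 <_) (sym eq) z<s) in e , trans (sym (lab-label e)) eq

  -- Properness makes the edges of one label a matching, so each vertex merges with at most one
  -- neighbour per time step.
  lab-injective : ∀ {k v w x} → lab v w ≡ suc k → lab v x ≡ suc k → w ≡ x
  lab-injective {w = w} {x} eq₁ eq₂ with w Fin.≟ x | suc-edge eq₁ | suc-edge eq₂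
  ... | yes w≡x | _       | _       = w≡x
  ... | no  w≢x | e , le  | f , lf  = contradiction (trans le (sym lf)) (proper e f w≢x)

  -- Temporal walks with bounded labels.

  Reach : ℕ → Fin n → Fin n → Set
  Reach k x v = Σ[ p ∈ Walk x v ] IsTemporal p × All (_≤ k) (labels p)

  weaken : ∀ {k x v} → Reach k x v → Reach (suc k) x v
  weaken (p , t , p≤k) = p , t , All.map m≤n⇒m≤1+n p≤k

  labels-◅◅ : ∀ {x v w} (p : Walk x v) (q : Walk v w) → labels (p ◅◅ q) ≡ labels p ++ labels q
  labels-◅◅ ε       q = refl
  labels-◅◅ (e ◅ p) q = cong (label e ∷_) (labels-◅◅ p q)

  linked-∷ʳ : ∀ {xs k} → Linked _<_ xs → All (_≤ k) xs → Linked _<_ (xs ++ [ suc k ])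
  linked-∷ʳ []       []         = [-]
  linked-∷ʳ [-]      (x≤k ∷ []) = s≤s x≤k ∷ [-]
  linked-∷ʳ (r ∷ rs) (_ ∷ xs≤k) = r ∷ linked-∷ʳ rs xs≤k

  labels-snoc : ∀ {k x v w} (p : Walk x v) (e : v ~ w) → label e ≡ suc k →
    labels (p ◅◅ e ◅ ε) ≡ labels p ++ [ suc k ]
  labels-snoc p e le = trans (labels-◅◅ p (e ◅ ε)) (cong (λ l → labels p ++ [ l ]) le)

  snoc-temporal : ∀ {k x v w} ((p , _) : Reach k x v) (e : v ~ w) → label e ≡ suc k →
    IsTemporal (p ◅◅ e ◅ ε)
  snoc-temporal (p , t , p≤k) e le =
    subst (Linked _<_) (sym (labels-snoc p e le)) (linked-∷ʳ t p≤k)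

  snoc : ∀ {k x v w} → Reach k x v → (e : v ~ w) → label e ≡ suc k → Reach (suc k) x w
  snoc r@(p , t , p≤k) e le = p ◅◅ e ◅ ε , snoc-temporal r e le ,
    subst (All _) (sym (labels-snoc p e le)) (All.++⁺ (All.map m≤n⇒m≤1+n p≤k) (≤-refl ∷ []))

  -- Appending `e` to the walk ending at `v` gives another temporal walk from `x` to `w`.
  -- Two-path-freeness identifies it with the given one, whose labels are at most `k`, although its
  -- last label is `suc k`.
  reach-unique-last : ∀ {k x v w} → x ≢ w → Reach k x v → Reach k x w →
    (e : v ~ w) → label e ≡ suc k → ⊥
  reach-unique-last {k} x≢w r@(p , _) (q , t , q≤k) e le = 1+n≰n (All.head suc-k≤k)
    where
    q≡p∷ʳe : q ≡ p ◅◅ e ◅ ε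
    q≡p∷ʳe = tpf x≢w q (p ◅◅ e ◅ ε) t (snoc-temporal r e le)
    suc-k≤k : All (_≤ k) [ suc k ]
    suc-k≤k = All.++⁻ʳ (labels p)
      (subst (All (_≤ k)) (trans (cong labels q≡p∷ʳe) (labels-snoc p e le)) q≤k)

  -- Two-path-freeness concerns distinct ends only, but `x` cannot equal both ends of `e`. If it is
  -- `w`, the argument runs at `v` with `e` reversed.
  reach-disjoint : ∀ {k x v w} → Reach k x v → Reach k x w → (e : v ~ w) → label e ≡ suc k → ⊥
  reach-disjoint {x = x} {v} {w} r s e le with x Fin.≟ w
  ... | no  x≢w  = reach-unique-last x≢w r s e le
  ... | yes refl = reach-unique-last (λ w≡v → ~-irrefl (sym w≡v) e) s r (~-sym e) (trans (label-sym e) le)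

  -- Growth of the sets of origins.

  -- The set S k v of the introduction, without repetitions.
  origins : ℕ → Fin n → List (Fin n)
  origins zero    v = [ v ]
  origins (suc k) v with any? (λ w → lab v w ≟ suc k)
  ... | yes (w , _) = origins k v ++ origins k w
  ... | no  _       = origins k v

  origins-reach : ∀ k v → All (λ x → Reach k x v) (origins k v)
  origins-reach zero v = (ε , [] , []) ∷ []
  origins-reach (suc k) v with any? (λ w → lab v w ≟ suc k)
  ... | yes (w , eq) = All.++⁺ (All.map weaken (origins-reach k v))
      (let e , le = suc-edge eq in
       -- These walks end at `w`, so the edge is traversed from `w` to `v`.
       All.map (λ r → snoc r (~-sym e) (trans (label-sym e) le)) (origins-reach k w))
  ... | no  _ = All.map weaken (origins-reach k v)

  origins-disjoint : ∀ {k v w} → lab v w ≡ suc k → Disjoint (origins k v) (origins k w)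
  origins-disjoint {k} {v} {w} eq (x∈v , x∈w) = let e , le = suc-edge eq in
    reach-disjoint (All.lookup (origins-reach k v) x∈v) (All.lookup (origins-reach k w) x∈w) e le

  origins-unique : ∀ k v → Unique (origins k v)
  origins-unique zero v = [] ∷ []
  origins-unique (suc k) v with any? (λ w → lab v w ≟ suc k)
  ... | yes (w , eq) = Unique.++⁺ (origins-unique k v) (origins-unique k w) (origins-disjoint eq)
  ... | no  _        = origins-unique k v

  size : ℕ → Fin n → ℕ
  size k v = length (origins k v)

  size-mono : ∀ k v → size k v ≤ size (suc k) v
  size-mono k v with any? (λ w → lab v w ≟ suc k)
  ... | yes (w , _) = ≤-trans (m≤m+n _ _) (≤-reflexive (sym (length-++ (origins k v))))
  ... | no  _       = ≤-refl

  size-suc : ∀ {k v w} → lab v w ≡ suc k → size (suc k) v ≡ size k v + size k w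
  size-suc {k} {v} {w} eq with any? (λ w → lab v w ≟ suc k)
  -- The neighbour found by the search must be the given `w`.
  ... | yes (x , eq′) rewrite lab-injective eq eq′ = length-++ (origins k v)
  ... | no  ∄w        = contradiction (w , eq) ∄w

  -- Charging edges to endpoints.

  -- `pred (lab v w)` is the time just before the edge appears. In a tie both orientations are
  -- charged, and `orient` selects one.
  Charged : Fin n → Fin n → Set
  Charged v w = 0 < lab v w × size (pred (lab v w)) v ≤ size (pred (lab v w)) w

  charged-doubles : ∀ {k v w} → Charged v w → lab v w ≡ suc k → 2 * size k v ≤ size (suc k) v
  charged-doubles {k} {v} {w} (_ , sv≤sw) eq = begin
    size k v + (size k v + 0) ≡⟨ cong (size k v +_) (+-identityʳ _) ⟩
    size k v + size k v       ≤⟨ +-monoʳ-≤ _ (subst (λ l → size (pred l) v ≤ size (pred l) w) eq sv≤sw) ⟩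
    size k v + size k w       ≡⟨ sym (size-suc eq) ⟩
    size (suc k) v            ∎
    where open ≤-Reasoning

  -- Induction on time: neighbours with label at most `k` fall under the induction hypothesis, and
  -- at most one has label `suc k`, which doubles the set.
  2^charges≤size : ∀ k v {ws} → Unique ws → All (Charged v) ws → All (λ w → lab v w ≤ k) ws →
    2 ^ length ws ≤ size k v
  2^charges≤size zero    v []      []             []        = ≤-refl
  2^charges≤size zero    v (_ ∷ _) ((0<l , _) ∷ _) (l≤0 ∷ _) = contradiction l≤0 (<⇒≱ 0<l)
  2^charges≤size (suc k) v {ws} u ch ws≤ = subst (λ l → 2 ^ l ≤ size (suc k) v)
    (sym (length-filter-¬ early? ws))
    (add-late (Unique.filter⁺ (¬? ∘ early?) u) (All.filter⁺ (¬? ∘ early?) ch)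
      (All.map (λ (l≤1+k , l≰k) → ≤-antisym l≤1+k (≰⇒> l≰k))
        (All.zip (All.filter⁺ (¬? ∘ early?) ws≤ , all-filter (¬? ∘ early?) ws))))
    where
    early? : Decidable (λ w → lab v w ≤ k)
    early? w = lab v w ≤? k
    early = filter early? ws
    early-bound : 2 ^ length early ≤ size k v
    early-bound = 2^charges≤size k v (Unique.filter⁺ early? u) (All.filter⁺ early? ch) (all-filter early? ws)
    -- `late` is an arbitrary list here so that it can be matched on.
    add-late : ∀ {late} → Unique late → All (Charged v) late → All (λ w → lab v w ≡ suc k) late →
      2 ^ (length early + length late) ≤ size (suc k) v
    add-late [] [] [] rewrite +-identityʳ (length early) = ≤-trans early-bound (size-mono k v)
    add-late (_ ∷ []) (c ∷ []) (eq ∷ []) rewrite +-comm (length early) 1 =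
      ≤-trans (*-monoʳ-≤ 2 early-bound) (charged-doubles c eq)
    add-late ((x≢y ∷ _) ∷ _) _ (eq₁ ∷ eq₂ ∷ _) = contradiction (lab-injective eq₁ eq₂) x≢y

  charges≤log : ∀ v {ws} → Unique ws → All (Charged v) ws → length ws ≤ ⌊log₂ n ⌋
  charges≤log v {ws} u ch with bounded (lab v) ws
  ... | k , ws≤k = 2^m≤n⇒m≤⌊log₂n⌋ (length ws)
    (≤-trans (2^charges≤size k v u ch ws≤k) (unique-length (origins-unique k v)))

  -- Once the first component is fixed, `proj₂` is injective, so the pairs can be counted as
  -- neighbours of `v`.
  charged-fibre : ∀ v {ds} → Unique ds → All (λ (x , y) → Charged x y) ds →
    All (λ d → proj₁ d ≡ v) ds → length ds ≤ ⌊log₂ n ⌋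
  charged-fibre v {ds} u ch at-v = subst (_≤ _) (length-map proj₂ ds)
    (charges≤log v (map-unique proj₂ (λ { refl refl refl → refl }) at-v u)
      (All.map⁺ (All.map (λ { (c , refl) → c }) (All.zip (ch , at-v)))))

  -- Orients an edge so that it starts at the endpoint to which it is charged.
  orient : Fin n × Fin n → Fin n × Fin n
  orient (v , w) with size (pred (lab v w)) v ≤? size (pred (lab v w)) w
  ... | yes _ = v , w
  ... | no  _ = w , v

  orient-charged : ∀ {v w} → v ~ w → (λ (x , y) → Charged x y) (orient (v , w))
  orient-charged {v} {w} e with size (pred (lab v w)) v ≤? size (pred (lab v w)) w
  ... | yes sv≤sw = subst (0 <_) (sym (lab-label e)) (label-pos e) , sv≤sw
  ... | no  sv≰sw = subst (0 <_) (sym (lab-label (~-sym e))) (label-pos (~-sym e)) ,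
    -- The comparison was made at `lab v w`, while `Charged w v` refers to `lab w v`.
    subst (λ l → size (pred l) w ≤ size (pred l) v)
      (lab-sym (subst (0 <_) (sym (lab-label e)) (label-pos e))) (≰⇒≥ sv≰sw)

  -- If only one of two pairs with the same image were swapped, they would be reverses of each
  -- other, which the vertex order excludes.
  orient-injective : ∀ {d d′} → proj₁ d Fin.< proj₂ d → proj₁ d′ Fin.< proj₂ d′ →
    orient d ≡ orient d′ → d ≡ d′
  orient-injective {v , w} {v′ , w′} v<w v′<w′ eq
    with size (pred (lab v w)) v ≤? size (pred (lab v w)) w
       | size (pred (lab v′ w′)) v′ ≤? size (pred (lab v′ w′)) w′ | eq
  ... | yes _ | yes _ | refl = refl
  ... | yes _ | no  _ | refl = contradiction v′<w′ (<-asym v<w)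
  ... | no  _ | yes _ | refl = contradiction v′<w′ (<-asym v<w)
  ... | no  _ | no  _ | refl = refl

  ∣E∣≤n*log : ∣E∣ ≤ n * ⌊log₂ n ⌋
  ∣E∣≤n*log = begin
    length edges                     ≡⟨ sym (length-map orient edges) ⟩
    -- After orientation, the fibre of `proj₁` over a vertex consists of the edges charged to it.
    length (map orient edges)        ≤⟨ length≤fibres proj₁ charged-fibre (allFin n)
                                          (map-unique orient orient-injective (All.map proj₁ edges-edge) edges-unique)
                                          (All.map⁺ (All.map (orient-charged ∘ proj₂) edges-edge))
                                          (All.universal (λ _ → ∈-allFin _) _) ⟩
    length (allFin n) * ⌊log₂ n ⌋    ≡⟨ cong (_* ⌊log₂ n ⌋) (length-tabulate {n = n} id) ⟩
    n * ⌊log₂ n ⌋                    ∎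
    where
    open ≤-Reasoning
    edges-edge : All (λ (v , w) → v Fin.< w × v ~ w) edges
    edges-edge = all-filter _ (cartesianProduct (allFin n) (allFin n))
    edges-unique : Unique edges
    edges-unique = Unique.filter⁺ _ (Unique.cartesianProduct⁺ (Unique.allFin⁺ n) (Unique.allFin⁺ n))

lemma3p11 : ∃[ C ] (0 < C × (∀ (n : ℕ) → 2 ≤ n → (G : HappyTemporalGraph n) →
    HappyTemporalGraph.Compressed G → HappyTemporalGraph.TwoPathFree G →
    HappyTemporalGraph.∣E∣ G ≤ C * (n * ⌊log₂ n ⌋)))
-- With the binary logarithm rounded down, the constant 1 suffices.
lemma3p11 = 1 , z<s , λ n _ G _ tpf →
  ≤-trans (∣E∣≤n*log G tpf) (≤-reflexive (sym (*-identityˡ _)))
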